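{- Let $\mathbb{P}^{\tilde e}$ be a constraint-free extended multi-adjoint logic program (EMALP) on an extended multi-adjoint lattice with carrier $L$, let $\neg\colon L\to L$ be an involutive negation operator, and let $\mathbb{P}$ be the corresponding multi-adjoint normal logic program (MANLP) of $\mathbb{P}^{\tilde e}$ built with $\neg$. Let $M^{\tilde e}\colon\Pi_{\mathbb{P}^{\tilde e}}\to L$ be an interpretation, and let $M\colon\Pi_{\mathbb{P}^{\tilde e}}\cup\{\mathrm{not}_q\mid q\in\mathcal{N}_{\mathbb{P}^{\tilde e}}\}\to L$ be given by $M(p)=M^{\tilde e}(p)$ if $p\in\Pi_{\mathbb{P}^{\tilde e}}$ and $M(\mathrm{not}_q)=\hat M(\neg q)$ for all $q\in\mathcal{N}_{\mathbb{P}^{\tilde e}}$. Then $M^{\tilde e}$ is a stable model of $\mathbb{P}^{\tilde e}$ if and only if $M$ is a stable model of $\mathbb{P}$.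
   Context: Adjoint pair: given a partially ordered set $(P,\leq)$, a pair $(\&,\leftarrow)$ of binary operations on $P$ is an adjoint pair if $\&$ is order-preserving in both arguments; $\leftarrow$ is order-preserving in its first argument (the consequent) and order-reversing in its second argument (the antecedent), i.e. $z\leftarrow y$ is increasing in $z$ and decreasing in $y$; and $x\leq (z\leftarrow y)$ iff $(x\& y)\leq z$ for all $x,y,z\in P$. Multi-adjoint lattice: a tuple $(L,\preceq,\leftarrow_1,\&_1,\dots,\leftarrow_r,\&_r)$ where $(L,\preceq)$ is a bounded lattice with bottom $\bot$ and top $\top$, each $(\&_i,\leftarrow_i)$ is an adjoint pair in $(L,\preceq)$, and $\top\&_i\vartheta=\vartheta\&_i\top=\vartheta$ for all $\vartheta\in L$ and all $i$. A negation operator is an order-reversing mapping $\neg\colon L\to L$ with $\neg\bot=\top$, $\neg\top=\bot$; it is involutive if $\neg\neg x=x$ for all $x$. A multi-adjoint lattice together with a negation operator is a multi-adjoint normal lattice. Extended aggregator: a mapping $@^e\colon L^n\to L$ on a complete lattice $(L,\preceq)$ which is order-preserving in its first $m$ arguments and order-reversing in its last $n-m$ arguments; one writes $@^e[x_1,\dots,x_m;x_{m+1},\dots,x_n]$. An extended multi-adjoint lattice is a multi-adjoint lattice, with $(L,\preceq)$ complete, enriched with a finite family of extended aggregators $@^e_1,\dots,@^e_k$ (arities $n$ and numbers $m$ may depend on the aggregator). An aggregator operator is a mapping $@\colon L^n\to L$ order-preserving in all arguments (no boundary conditions required). Constraint-free EMALP: a finite set $\mathbb{P}^{\tilde e}$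 of weighted rules $\langle p\leftarrow_i @^e[p_1,\dots,p_m;p_{m+1},\dots,p_n];\vartheta\rangle$, where $i\in\{1,\dots,r\}$, $@^e$ is one of the extended aggregators of the lattice, $\vartheta\in L$, and $p,p_1,\dots,p_n$ are propositional symbols with $p_1,\dots,p_n$ pairwise distinct. MANLP: on a multi-adjoint normal lattice, a finite set $\mathbb{P}$ of weighted rules $\langle p\leftarrow_i @[p_1,\dots,p_m,\neg p_{m+1},\dots,\neg p_n];\vartheta\rangle$, with $@$ an aggregator operator, $\vartheta\in L$, and $p,p_1,\dots,p_n$ propositional symbols with $p_1,\dots,p_n$ pairwise distinct. Semantics (both kinds of programs): $\Pi_{\mathbb{Q}}$ is the set of propositional symbols of a program $\mathbb{Q}$; an interpretation is a mapping $I\colon\Pi_{\mathbb{Q}}\to L$, extended to formulas inductively as $\hat I$ (so $\hat I(\neg q)=\neg(I(q))$ and elements of $L$ evaluate to themselves). Interpretations are ordered pointwise. A rule $\langle p\leftarrow_i\mathcal{B};\vartheta\rangle$ is satisfied by $I$ iff $\vartheta\preceq I(p)\leftarrow_i\hat I(\mathcal{B})$; a model satisfies all rules; the least model is a model that is pointwise $\preceq$ every model. Reducts and stable models: for an EMALP, the reduct with respect to an interpretation $M$ replaces each rule body $@^e[p_1,\dots,p_m;p_{m+1},\dots,p_n]$ by $@^e_M[p_1,\dots,p_m]$, where $@^e_M[\vartheta_1,\dots,\vartheta_m]=@^e[\vartheta_1,\dots,\vartheta_m;M(p_{m+1}),\dots,M(p_n)]$; for a MANLP it replaces each body $@[p_1,\dots,p_m,\neg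 p_{m+1},\dots,\neg p_n]$ by $@_M[p_1,\dots,p_m]$, where $@_M[\vartheta_1,\dots,\vartheta_m]=@[\vartheta_1,\dots,\vartheta_m,\neg M(p_{m+1}),\dots,\neg M(p_n)]$. (Models of a reduct are taken among interpretations with the same domain as $M$.) $M$ is a stable model of the program if it is the least model of its reduct with respect to $M$. Corresponding MANLP: let $\mathcal{N}_{\mathbb{P}^{\tilde e}}$ be the set of propositional symbols that appear in an order-reversing argument of an extended aggregator in the body of some rule of $\mathbb{P}^{\tilde e}$. For each $q\in\mathcal{N}_{\mathbb{P}^{\tilde e}}$ let $\mathrm{not}_q\notin\Pi_{\mathbb{P}^{\tilde e}}$ be a new propositional symbol (distinct for distinct $q$). Given an involutive negation operator $\neg$ on $L$, the corresponding MANLP $\mathbb{P}$, on the multi-adjoint normal lattice $(L,\preceq,\leftarrow_1,\&_1,\dots,\leftarrow_r,\&_r,\neg)$, consists of the rules $\langle p\leftarrow_i @[p_1,\dots,p_m,\mathrm{not}_{p_{m+1}},\dots,\mathrm{not}_{p_n}];\vartheta\rangle$ for every $\langle p\leftarrow_i @^e[p_1,\dots,p_m;p_{m+1},\dots,p_n];\vartheta\rangle\in\mathbb{P}^{\tilde e}$, together with one rule $\langle\mathrm{not}_q\leftarrow_j\neg q;\top\rangle$ for every $q\in\mathcal{N}_{\mathbb{P}^{\tilde e}}$ (with $j\in\{1,\dots,r\}$), where $@$ is the aggregator operator $@[\vartheta_1,\dots,\vartheta_n]=@^e[\vartheta_1,\dots,\vartheta_m;\neg\vartheta_{m+1},\dots,\neg\vartheta_n]$.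 -}

module Defs where

open import Level using (Level; _⊔_) renaming (suc to lsuc)
open import Data.Nat.Base using (ℕ; _+_)
open import Data.Fin.Base using (Fin; zero; splitAt; _↑ˡ_; _↑ʳ_)
open import Data.Fin.Properties using (splitAt⁻¹-↑ˡ; splitAt⁻¹-↑ʳ; ↑ˡ-injective; ↑ʳ-injective)
open import Data.List.Base as List using (List; concatMap)
open import Data.List.Membership.Propositional using (_∈_; _∉_; lose; mapWith∈)
open import Data.List.Membership.Propositional.Properties
  using (∈-++⁺ˡ; ∈-++⁺ʳ; ∈-concatMap⁺; ∈-tabulate⁺)
open import Data.List.Relation.Unary.Any using (here; there)
open import Data.Product.Base using (Σ; ∃; _×_; _,_; proj₁)
open import Data.Sum.Base using (inj₁; inj₂)
open import Data.Vec.Functional as Vector using (Vector; _++_; take; drop; toList)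
open import Data.Vec.Functional.Properties using (lookup-++ˡ; lookup-++ʳ)
open import Data.Vec.Functional.Relation.Binary.Pointwise using (Pointwise)
open import Data.Vec.Functional.Relation.Binary.Pointwise.Properties using (++⁺)
open import Function.Base using (_∘_)
open import Function.Bundles using (_⇔_; Func; _⟨$⟩_)
open import Function.Definitions using (Injective)
open import Relation.Binary.Bundles using (Poset; Setoid)
open import Relation.Binary.Definitions
  using (Monotonic₁; Antitonic₁; Monotonic₂; MonotonicAntitonic)
open import Relation.Binary.Lattice.Bundles using (BoundedLattice)
open import Relation.Binary.PropositionalEquality as ≡ using (_≡_; _≢_)
open import Relation.Nullary.Negation using (contradiction)
import Algebra.Definitions as AlgebraDefinitions
import Relation.Binary.Construct.On as On

module _ {c ℓ₁ ℓ₂ : Level} (P : Poset c ℓ₁ ℓ₂) where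
  open Poset P

  record IsAdjointPair (_&_ _←_ : Carrier → Carrier → Carrier) : Set (c ⊔ ℓ₂) where
    field
      &-mono  : Monotonic₂ _≤_ _≤_ _≤_ _&_
      ←-mono  : MonotonicAntitonic _≤_ _≤_ _≤_ _←_
      adjoint : ∀ x y z → (x ≤ (z ← y)) ⇔ ((x & y) ≤ z)

  module _ {ι : Level} {I : Set ι} (f : I → Carrier) where

    IsSupremum : Carrier → Set (c ⊔ ℓ₂ ⊔ ι)
    IsSupremum s = (∀ i → f i ≤ s) × (∀ u → (∀ i → f i ≤ u) → s ≤ u)

    IsInfimum : Carrier → Set (c ⊔ ℓ₂ ⊔ ι)
    IsInfimum s = (∀ i → s ≤ f i) × (∀ u → (∀ i → u ≤ f i) → u ≤ s)

  -- Subsets are presented as families indexed by sets of level ι.  A subset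
  -- A : Pred Carrier a is the family proj₁ : Σ Carrier A → Carrier, of index
  -- level c ⊔ a.  The level ι is kept apart from c because, predicatively,
  -- complete lattices such as (Set ι, →) are larger than the families of
  -- which they have suprema.
  record IsComplete (ι : Level) : Set (c ⊔ ℓ₂ ⊔ lsuc ι) where
    field
      supremum : {I : Set ι} (f : I → Carrier) → ∃ (IsSupremum f)
      infimum  : {I : Set ι} (f : I → Carrier) → ∃ (IsInfimum f)

  record AggregatorOperator (n : ℕ) : Set (c ⊔ ℓ₂) where
    field
      apply : Vector Carrier n → Carrier
      mono  : Monotonic₁ (Pointwise _≤_) _≤_ apply

  record ExtendedAggregator : Set (c ⊔ ℓ₂) where
    field
      m k   : ℕ
      apply : Vector Carrier (m + k) → Carrier
      mono  : ∀ {v w} → Pointwise _≤_ (take m v) (take m w) →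
              Pointwise _≤_ (drop m w) (drop m v) → apply v ≤ apply w

record MultiAdjointLattice (c ℓ₁ ℓ₂ : Level) : Set (lsuc (c ⊔ ℓ₁ ⊔ ℓ₂)) where
  field
    boundedLattice : BoundedLattice c ℓ₁ ℓ₂
  open BoundedLattice boundedLattice public
  open AlgebraDefinitions _≈_ using (Identity)
  field
    r             : ℕ
    conj          : Fin r → Carrier → Carrier → Carrier
    impl          : Fin r → Carrier → Carrier → Carrier
    isAdjointPair : ∀ i → IsAdjointPair poset (conj i) (impl i)
    conj-identity : ∀ i → Identity ⊤ (conj i)

  infix 5 _←⟨_⟩_
  _←⟨_⟩_ : Carrier → Fin r → Carrier → Carrier
  z ←⟨ i ⟩ y = impl i z y

record NegationOperator {c ℓ₁ ℓ₂ : Level} (𝓛 : MultiAdjointLattice c ℓ₁ ℓ₂) :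
                        Set (c ⊔ ℓ₁ ⊔ ℓ₂) where
  open MultiAdjointLattice 𝓛
  infix 8 ¬_
  field
    ¬_       : Carrier → Carrier
    antitone : Antitonic₁ _≤_ _≤_ ¬_
    ¬⊥≈⊤     : ¬ ⊥ ≈ ⊤
    ¬⊤≈⊥     : ¬ ⊤ ≈ ⊥

  open AlgebraDefinitions _≈_ using (Involutive)

  IsInvolutive : Set (c ⊔ ℓ₁)
  IsInvolutive = Involutive ¬_

record MultiAdjointNormalLattice (c ℓ₁ ℓ₂ : Level) : Set (lsuc (c ⊔ ℓ₁ ⊔ ℓ₂)) where
  field
    multiAdjointLattice : MultiAdjointLattice c ℓ₁ ℓ₂
    negationOperator    : NegationOperator multiAdjointLattice
  open MultiAdjointLattice multiAdjointLattice public
  open NegationOperator negationOperator public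

record ExtendedMultiAdjointLattice (c ℓ₁ ℓ₂ ι : Level) :
                                   Set (lsuc (c ⊔ ℓ₁ ⊔ ℓ₂ ⊔ ι)) where
  field
    multiAdjointLattice : MultiAdjointLattice c ℓ₁ ℓ₂
  open MultiAdjointLattice multiAdjointLattice public
  field
    isComplete   : IsComplete poset ι
    #aggregators : ℕ
    aggregator   : Fin #aggregators → ExtendedAggregator poset
  module Agg (a : Fin #aggregators) = ExtendedAggregator (aggregator a)

module _ {s : Level} {Sym : Set s} where

  -- The set of symbols occurring in a list.  Interpretations are setoid
  -- functions on it, so they depend on the symbol only and not on the
  -- proof that it occurs.
  Occurring : List Sym → Setoid s s
  Occurring xs = On.setoid (≡.setoid Sym) (proj₁ {B = _∈ xs})

module _ {c ℓ₁ ℓ₂ : Level} (𝓛 : MultiAdjointLattice c ℓ₁ ℓ₂) where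
  open MultiAdjointLattice 𝓛

  Interpretation : {s : Level} {Sym : Set s} → List Sym → Set (c ⊔ ℓ₁ ⊔ s)
  Interpretation Π = Func (Occurring Π) setoid

  -- Rules ⟨ p ←ᵢ @[p₁,…,pₙ]; ϑ ⟩ of reducts.  The symbols are taken from the
  -- domain Π of the interpretation defining the reduct, which may be larger
  -- than the set of symbols occurring in the reduct itself.
  record PositiveRule {s : Level} {Sym : Set s} (Π : List Sym) : Set (c ⊔ ℓ₂ ⊔ s) where
    open Setoid (Occurring Π) using () renaming (Carrier to Symbol)
    field
      head   : Symbol
      index  : Fin r
      arity  : ℕ
      op     : AggregatorOperator poset arity
      args   : Vector Symbol arity
      weight : Carrier

  module _ {s : Level} {Sym : Set s} {Π : List Sym} where

    Satisfies : Interpretation Π → PositiveRule Π → Set ℓ₂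
    Satisfies I ρ =
      weight ≤ ((I ⟨$⟩ head) ←⟨ index ⟩ AggregatorOperator.apply op (Vector.map (I ⟨$⟩_) args))
      where open PositiveRule ρ

    IsModel : List (PositiveRule Π) → Interpretation Π → Set (c ⊔ ℓ₂ ⊔ s)
    IsModel ℚ I = ∀ {ρ} → ρ ∈ ℚ → Satisfies I ρ

    IsLeastModel : List (PositiveRule Π) → Interpretation Π → Set (c ⊔ ℓ₁ ⊔ ℓ₂ ⊔ s)
    IsLeastModel ℚ I =
      IsModel ℚ I × (∀ J → IsModel ℚ J → ∀ p → (I ⟨$⟩ p) ≤ (J ⟨$⟩ p))

module _ {a : Level} {A : Set a} {m k : ℕ} {xs : Vector A m} {ys : Vector A k} where

  ++-distinctˡ : Injective _≡_ _≡_ (xs ++ ys) → Injective _≡_ _≡_ xs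
  ++-distinctˡ inj {i} {j} eq = ↑ˡ-injective k i j (inj
    (≡.trans (lookup-++ˡ xs ys i) (≡.trans eq (≡.sym (lookup-++ˡ xs ys j)))))

  ++-distinctʳ : Injective _≡_ _≡_ (xs ++ ys) → Injective _≡_ _≡_ ys
  ++-distinctʳ inj {i} {j} eq = ↑ʳ-injective m i j (inj
    (≡.trans (lookup-++ʳ xs ys i) (≡.trans eq (≡.sym (lookup-++ʳ xs ys j)))))

  ++-distinct : Injective _≡_ _≡_ xs → Injective _≡_ _≡_ ys →
                (∀ i j → xs i ≢ ys j) → Injective _≡_ _≡_ (xs ++ ys)
  ++-distinct injˡ injʳ disj {i} {j} eq
    with splitAt m i in eqᵢ | splitAt m j in eqⱼ
  ... | inj₁ i′ | inj₁ j′ = ≡.trans (≡.sym (splitAt⁻¹-↑ˡ eqᵢ))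
                              (≡.trans (≡.cong (_↑ˡ k) (injˡ eq)) (splitAt⁻¹-↑ˡ eqⱼ))
  ... | inj₁ i′ | inj₂ j′ = contradiction eq (disj i′ j′)
  ... | inj₂ i′ | inj₁ j′ = contradiction (≡.sym eq) (disj j′ i′)
  ... | inj₂ i′ | inj₂ j′ = ≡.trans (≡.sym (splitAt⁻¹-↑ʳ {i = i} eqᵢ))
                              (≡.trans (≡.cong (m ↑ʳ_) (injʳ eq)) (splitAt⁻¹-↑ʳ {i = j} eqⱼ))

module _ {c ℓ₁ ℓ₂ : Level} (𝓝 : MultiAdjointNormalLattice c ℓ₁ ℓ₂) {s : Level} (Sym : Set s) where
  open MultiAdjointNormalLattice 𝓝

  record NormalRule : Set (c ⊔ ℓ₂ ⊔ s) where
    field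
      head     : Sym
      index    : Fin r
      m k      : ℕ
      op       : AggregatorOperator poset (m + k)
      pos      : Vector Sym m
      neg      : Vector Sym k
      distinct : Injective _≡_ _≡_ (pos ++ neg)
      weight   : Carrier

    symbols : List Sym
    symbols = head List.∷ toList pos List.++ toList neg

  -- A finite set of rules; multiplicity and order do not affect models.
  MANLP : Set (c ⊔ ℓ₂ ⊔ s)
  MANLP = List NormalRule

module _ {c ℓ₁ ℓ₂ : Level} {𝓝 : MultiAdjointNormalLattice c ℓ₁ ℓ₂} {s : Level} {Sym : Set s} where
  open MultiAdjointNormalLattice 𝓝

  Πⁿ : MANLP 𝓝 Sym → List Sym
  Πⁿ = concatMap NormalRule.symbols

  module _ (ℙ : MANLP 𝓝 Sym) (M : Interpretation multiAdjointLattice (Πⁿ ℙ)) where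

    reductRuleⁿ : {ρ : NormalRule 𝓝 Sym} → ρ ∈ ℙ → PositiveRule multiAdjointLattice (Πⁿ ℙ)
    reductRuleⁿ {ρ} ρ∈ℙ = record
      { head   = head , occurs (here ≡.refl)
      ; index  = index
      ; arity  = m
      ; op     = record
        { apply = λ ϑ → apply (ϑ ++ λ j → ¬ (M ⟨$⟩ negSymbol j))
        ; mono  = λ v≤w → mono (++⁺ _≤_ v≤w (λ _ → refl))
        }
      ; args   = λ i → pos i , occurs (there (∈-++⁺ˡ (∈-tabulate⁺ i)))
      ; weight = weight
      }
      where
      open NormalRule ρ
      open AggregatorOperator op

      occurs : ∀ {p} → p ∈ symbols → p ∈ Πⁿ ℙ
      occurs p∈ρ = ∈-concatMap⁺ NormalRule.symbols (lose ρ∈ℙ p∈ρ)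

      negSymbol : Fin k → Σ Sym (_∈ Πⁿ ℙ)
      negSymbol j = neg j , occurs (there (∈-++⁺ʳ (toList pos) (∈-tabulate⁺ j)))

    reductⁿ : List (PositiveRule multiAdjointLattice (Πⁿ ℙ))
    reductⁿ = mapWith∈ ℙ reductRuleⁿ

    IsStableModelⁿ : Set (c ⊔ ℓ₁ ⊔ ℓ₂ ⊔ s)
    IsStableModelⁿ = IsLeastModel multiAdjointLattice reductⁿ M

module _ {c ℓ₁ ℓ₂ ι : Level} (𝓔 : ExtendedMultiAdjointLattice c ℓ₁ ℓ₂ ι)
         {s : Level} (Sym : Set s) where
  open ExtendedMultiAdjointLattice 𝓔

  record ExtendedRule : Set (c ⊔ s) where
    field
      head     : Sym
      index    : Fin r
      agg      : Fin #aggregators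
      pos      : Vector Sym (Agg.m agg)
      neg      : Vector Sym (Agg.k agg)
      distinct : Injective _≡_ _≡_ (pos ++ neg)
      weight   : Carrier

    symbols : List Sym
    symbols = head List.∷ toList pos List.++ toList neg

  EMALP : Set (c ⊔ s)
  EMALP = List ExtendedRule

module _ {c ℓ₁ ℓ₂ ι : Level} {𝓔 : ExtendedMultiAdjointLattice c ℓ₁ ℓ₂ ι}
         {s : Level} {Sym : Set s} where
  open ExtendedMultiAdjointLattice 𝓔

  Πᵉ : EMALP 𝓔 Sym → List Sym
  Πᵉ = concatMap ExtendedRule.symbols

  𝒩 : EMALP 𝓔 Sym → List Sym
  𝒩 = concatMap (λ ρ → toList (ExtendedRule.neg ρ))

  module _ (ℙ : EMALP 𝓔 Sym) (M : Interpretation multiAdjointLattice (Πᵉ ℙ)) where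

    reductRuleᵉ : {ρ : ExtendedRule 𝓔 Sym} → ρ ∈ ℙ → PositiveRule multiAdjointLattice (Πᵉ ℙ)
    reductRuleᵉ {ρ} ρ∈ℙ = record
      { head   = head , occurs (here ≡.refl)
      ; index  = index
      ; arity  = m
      ; op     = record
        { apply = λ ϑ → apply (ϑ ++ fixed)
        ; mono  = λ {v} {w} v≤w → mono
            (λ i → ≡.subst₂ _≤_ (≡.sym (lookup-++ˡ v fixed i)) (≡.sym (lookup-++ˡ w fixed i)) (v≤w i))
            (λ j → ≡.subst₂ _≤_ (≡.sym (lookup-++ʳ w fixed j)) (≡.sym (lookup-++ʳ v fixed j))
                     refl)
        }
      ; args   = λ i → pos i , occurs (there (∈-++⁺ˡ (∈-tabulate⁺ i)))
      ; weight = weight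
      }
      where
      open ExtendedRule ρ
      open Agg agg

      occurs : ∀ {p} → p ∈ symbols → p ∈ Πᵉ ℙ
      occurs p∈ρ = ∈-concatMap⁺ ExtendedRule.symbols (lose ρ∈ℙ p∈ρ)

      fixed : Vector Carrier k
      fixed j = M ⟨$⟩ (neg j , occurs (there (∈-++⁺ʳ (toList pos) (∈-tabulate⁺ j))))

    reductᵉ : List (PositiveRule multiAdjointLattice (Πᵉ ℙ))
    reductᵉ = mapWith∈ ℙ reductRuleᵉ

    IsStableModelᵉ : Set (c ⊔ ℓ₁ ⊔ ℓ₂ ⊔ s)
    IsStableModelᵉ = IsLeastModel multiAdjointLattice reductᵉ M

module _ {c ℓ₁ ℓ₂ ι : Level} {𝓔 : ExtendedMultiAdjointLattice c ℓ₁ ℓ₂ ι}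
         {s : Level} {Sym : Set s} where
  open ExtendedMultiAdjointLattice 𝓔

  -- The symbol not_q is not q; values of not outside 𝒩 ℙ are never used.
  record IsFresh (ℙ : EMALP 𝓔 Sym) (not : Sym → Sym) : Set s where
    field
      not∉Π         : ∀ {q} → q ∈ 𝒩 ℙ → not q ∉ Πᵉ ℙ
      not-injective : ∀ {q q′} → q ∈ 𝒩 ℙ → q′ ∈ 𝒩 ℙ → not q ≡ not q′ → q ≡ q′

  normalLattice : NegationOperator multiAdjointLattice → MultiAdjointNormalLattice c ℓ₁ ℓ₂
  normalLattice ν = record { multiAdjointLattice = multiAdjointLattice ; negationOperator = ν }

  module _ (ν : NegationOperator multiAdjointLattice) where
    open NegationOperator ν

    toAggregatorOperator : (α : ExtendedAggregator poset) →
                           AggregatorOperator poset (ExtendedAggregator.m α + ExtendedAggregator.k α)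
    toAggregatorOperator α = record
      { apply = λ ϑ → apply (args ϑ)
      ; mono  = λ {v} {w} v≤w → mono
          (λ i → ≡.subst₂ _≤_ (≡.sym (lookup-++ˡ (take m v) _ i)) (≡.sym (lookup-++ˡ (take m w) _ i))
                   (v≤w (i ↑ˡ k)))
          (λ j → ≡.subst₂ _≤_ (≡.sym (lookup-++ʳ (take m w) _ j)) (≡.sym (lookup-++ʳ (take m v) _ j))
                   (antitone (v≤w (m ↑ʳ j))))
      }
      where
      open ExtendedAggregator α

      args : Vector Carrier (m + k) → Vector Carrier (m + k)
      args ϑ = take m ϑ ++ Vector.map ¬_ (drop m ϑ)

    module _ (ℙ : EMALP 𝓔 Sym) (not : Sym → Sym) (fresh : IsFresh ℙ not) (j : Sym → Fin r) where
      open IsFresh fresh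

      -- The body has no negated symbols, so its aggregator has arity (m + k) + 0.
      translateRule : {ρ : ExtendedRule 𝓔 Sym} → ρ ∈ ℙ → NormalRule (normalLattice ν) Sym
      translateRule {ρ} ρ∈ℙ = record
        { head     = head
        ; index    = index
        ; m        = m + k
        ; k        = 0
        ; op       = record
          { apply = λ ϑ → apply (take (m + k) ϑ)
          ; mono  = λ v≤w → mono (λ i → v≤w (i ↑ˡ 0))
          }
        ; pos      = pos ++ Vector.map not neg
        ; neg      = Vector.[]
        ; distinct = ++-distinct
            (++-distinct (++-distinctˡ distinct)
              (λ eq → ++-distinctʳ {xs = pos} distinct (not-injective (neg∈𝒩 _) (neg∈𝒩 _) eq))
              (λ i j′ eq → not∉Π (neg∈𝒩 j′) (≡.subst (_∈ Πᵉ ℙ) eq (pos∈Π i))))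
            (λ { {()} })
            (λ { _ () })
        ; weight   = weight
        }
        where
        open ExtendedRule ρ
        open Agg agg using (m; k)
        open AggregatorOperator (toAggregatorOperator (aggregator agg))

        pos∈Π : ∀ i → pos i ∈ Πᵉ ℙ
        pos∈Π i = ∈-concatMap⁺ ExtendedRule.symbols (lose ρ∈ℙ (there (∈-++⁺ˡ (∈-tabulate⁺ i))))

        neg∈𝒩 : ∀ i → neg i ∈ 𝒩 ℙ
        neg∈𝒩 i = ∈-concatMap⁺ (λ ρ → toList (ExtendedRule.neg ρ)) (lose ρ∈ℙ (∈-tabulate⁺ i))

      -- ⟨ not q ←ⱼ ¬ q ; ⊤ ⟩, whose body is the unary identity operator applied to ¬ q.
      negationRule : Sym → NormalRule (normalLattice ν) Sym
      negationRule q = record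
        { head     = not q
        ; index    = j q
        ; m        = 0
        ; k        = 1
        ; op       = record { apply = λ ϑ → ϑ zero ; mono = λ v≤w → v≤w zero }
        ; pos      = Vector.[]
        ; neg      = λ _ → q
        ; distinct = λ { {zero} {zero} _ → ≡.refl }
        ; weight   = ⊤
        }

      correspondingMANLP : MANLP (normalLattice ν) Sym
      correspondingMANLP = mapWith∈ ℙ translateRule List.++ List.map negationRule (𝒩 ℙ)

{-# OPTIONS --safe #-}

-- Write ℙ for the corresponding MANLP.  In the reduct of ℙ the rule for not_q
-- says exactly ¬ M q ≤ K (not_q), so by involutivity the body of a translated
-- rule is, at any K with K (not_q) ≥ ¬ M q, at least the body of the original
-- rule in the reduct of ℙᵉ, with equality when K (not_q) = ¬ M q.  Hence
-- models of the reduct of ℙ restrict to models of the reduct of ℙᵉ, and a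
-- model of the latter extends to one of the former by not_q ↦ ¬ M q, which is
-- the least possible choice.
module Submission where

open import Defs
open import Level using (Level)
open import Data.Fin.Base using (Fin; splitAt; _↑ˡ_; _↑ʳ_)
open import Data.List.Base using (List)
open import Data.Nat.Base using (_+_)
open import Data.List.Membership.Propositional using (_∈_; find; lose; mapWith∈)
open import Data.List.Membership.Propositional.Properties
  using (∈-++⁺ˡ; ∈-++⁺ʳ; ∈-++⁻; ∈-concatMap⁺; ∈-concatMap⁻; ∈-map⁺; ∈-map⁻; ∈-tabulate⁺; ∈-tabulate⁻)
open import Data.List.Relation.Unary.Any using (here; there)
open import Data.List.Relation.Unary.Any.Properties using (mapWith∈⁺; mapWith∈⁻)
open import Data.Product.Base using (∃; _×_; _,_; proj₁)
open import Data.Sum.Base using (_⊎_; inj₁; inj₂)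
open import Data.Vec.Functional as Vector using (Vector; _++_; take; toList)
open import Data.Vec.Functional.Properties using (lookup-++ˡ; lookup-++ʳ)
open import Function.Base using (_$_; _∘_)
open import Function.Bundles using (_⇔_; Equivalence; Func; mk⇔; _⟨$⟩_)
open import Relation.Binary.PropositionalEquality as ≡ using (_≡_)
open import Relation.Nullary.Negation using (contradiction)

-- Weighted implications and models of lists of reduct rules.

module _ {c ℓ₁ ℓ₂ : Level} (𝓛 : MultiAdjointLattice c ℓ₁ ℓ₂) where
  open MultiAdjointLattice 𝓛

  -- Adjointness together with `⊤` being a left identity: a rule of weight `⊤` only demands that its
  -- body lie below its head.
  ⊤≤←⁺ : ∀ i {y z} → y ≤ z → ⊤ ≤ (z ←⟨ i ⟩ y)
  ⊤≤←⁺ i y≤z = Equivalence.from (IsAdjointPair.adjoint (isAdjointPair i) _ _ _)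
    (trans (reflexive (proj₁ (conj-identity i) _)) y≤z)

  ⊤≤←⁻ : ∀ i {y z} → ⊤ ≤ (z ←⟨ i ⟩ y) → y ≤ z
  ⊤≤←⁻ i ⊤≤ = trans (reflexive (Eq.sym (proj₁ (conj-identity i) _)))
    (Equivalence.to (IsAdjointPair.adjoint (isAdjointPair i) _ _ _) ⊤≤)

  ←-mono-≤ : ∀ i {w x x′ y y′} → x ≤ x′ → y′ ≤ y → w ≤ (x ←⟨ i ⟩ y) → w ≤ (x′ ←⟨ i ⟩ y′)
  ←-mono-≤ i x≤x′ y′≤y w≤ = trans w≤ (IsAdjointPair.←-mono (isAdjointPair i) x≤x′ y′≤y)

  module _ {a s : Level} {A : Set a} {Sym : Set s} {Π : List Sym} {xs : List A}
           {f : ∀ {x} → x ∈ xs → PositiveRule 𝓛 Π} {I : Interpretation 𝓛 Π} where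

    -- A reduct rule contains occurrence proofs and so depends on the proof that its source rule is
    -- in the program; satisfaction is therefore quantified over such proofs.
    IsModel-mapWith∈⁺ : (∀ {x} (x∈xs : x ∈ xs) → Satisfies 𝓛 I (f x∈xs)) →
                        IsModel 𝓛 (mapWith∈ xs f) I
    IsModel-mapWith∈⁺ sat ρ∈ with mapWith∈⁻ xs f ρ∈
    ... | _ , x∈xs , ≡.refl = sat x∈xs

    IsModel-mapWith∈⁻ : IsModel 𝓛 (mapWith∈ xs f) I →
                        ∀ {x} (x∈xs : x ∈ xs) → Satisfies 𝓛 I (f x∈xs)
    IsModel-mapWith∈⁻ model x∈xs = model (mapWith∈⁺ f (_ , x∈xs , ≡.refl))

module _ {c ℓ₁ ℓ₂ : Level} {𝓛 : MultiAdjointLattice c ℓ₁ ℓ₂} (ν : NegationOperator 𝓛) where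
  open MultiAdjointLattice 𝓛
  open NegationOperator ν

  ¬-cong : ∀ {x y} → x ≈ y → ¬ x ≈ ¬ y
  ¬-cong x≈y = antisym (antitone (reflexive (Eq.sym x≈y))) (antitone (reflexive x≈y))

-- Symbols of the extended program.

module _ {c ℓ₁ ℓ₂ ι s : Level} {𝓔 : ExtendedMultiAdjointLattice c ℓ₁ ℓ₂ ι} {Sym : Set s}
         (ℙᵉ : EMALP 𝓔 Sym) where

  head∈Πᵉ : ∀ {ρ} → ρ ∈ ℙᵉ → ExtendedRule.head ρ ∈ Πᵉ ℙᵉ
  head∈Πᵉ ρ∈ = ∈-concatMap⁺ ExtendedRule.symbols (lose ρ∈ (here ≡.refl))

  pos∈Πᵉ : ∀ {ρ} → ρ ∈ ℙᵉ → ∀ i → ExtendedRule.pos ρ i ∈ Πᵉ ℙᵉ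
  pos∈Πᵉ ρ∈ i = ∈-concatMap⁺ ExtendedRule.symbols (lose ρ∈ (there (∈-++⁺ˡ (∈-tabulate⁺ i))))

  neg∈𝒩 : ∀ {ρ} → ρ ∈ ℙᵉ → ∀ i → ExtendedRule.neg ρ i ∈ 𝒩 ℙᵉ
  neg∈𝒩 ρ∈ i = ∈-concatMap⁺ (toList ∘ ExtendedRule.neg) (lose ρ∈ (∈-tabulate⁺ i))

  𝒩⊆Πᵉ : ∀ {q} → q ∈ 𝒩 ℙᵉ → q ∈ Πᵉ ℙᵉ
  𝒩⊆Πᵉ q∈ with find (∈-concatMap⁻ (toList ∘ ExtendedRule.neg) {xs = ℙᵉ} q∈)
  ... | ρ , ρ∈ , q∈ρ = ∈-concatMap⁺ ExtendedRule.symbols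
    (lose ρ∈ (there (∈-++⁺ʳ (toList (ExtendedRule.pos ρ)) q∈ρ)))

-- Comparing an extended aggregator with its translation.

module _ {c ℓ₁ ℓ₂ ι s : Level} {𝓔 : ExtendedMultiAdjointLattice c ℓ₁ ℓ₂ ι} {Sym : Set s}
         (ν : NegationOperator (ExtendedMultiAdjointLattice.multiAdjointLattice 𝓔))
         (α : ExtendedAggregator (ExtendedMultiAdjointLattice.poset 𝓔)) where
  open ExtendedMultiAdjointLattice 𝓔
  open NegationOperator ν
  open ExtendedAggregator α
  open AggregatorOperator (toAggregatorOperator {𝓔 = 𝓔} {Sym = Sym} ν α)
    using () renaming (apply to apply¬)

  apply-++≤apply¬ : ∀ {x : Vector Carrier m} {y : Vector Carrier k} {v : Vector Carrier (m + k)} →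
                    (∀ i → x i ≤ v (i ↑ˡ k)) → (∀ i → ¬ v (m ↑ʳ i) ≤ y i) →
                    apply (x ++ y) ≤ apply¬ v
  apply-++≤apply¬ {x} {y} {v} x≤v ¬v≤y = mono
    (λ i → ≡.subst₂ _≤_ (≡.sym (lookup-++ˡ x y i)) (≡.sym (lookup-++ˡ (take m v) _ i)) (x≤v i))
    (λ i → ≡.subst₂ _≤_ (≡.sym (lookup-++ʳ (take m v) _ i)) (≡.sym (lookup-++ʳ x y i)) (¬v≤y i))

  apply¬≤apply-++ : ∀ {x : Vector Carrier m} {y : Vector Carrier k} {v : Vector Carrier (m + k)} →
                    (∀ i → v (i ↑ˡ k) ≤ x i) → (∀ i → y i ≤ ¬ v (m ↑ʳ i)) →
                    apply¬ v ≤ apply (x ++ y)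
  apply¬≤apply-++ {x} {y} {v} v≤x y≤¬v = mono
    (λ i → ≡.subst₂ _≤_ (≡.sym (lookup-++ˡ (take m v) _ i)) (≡.sym (lookup-++ˡ x y i)) (v≤x i))
    (λ i → ≡.subst₂ _≤_ (≡.sym (lookup-++ʳ x y i)) (≡.sym (lookup-++ʳ (take m v) _ i)) (y≤¬v i))

-- Rules and symbols of the corresponding MANLP.

module Translation
  {c ℓ₁ ℓ₂ ι s : Level} {𝓔 : ExtendedMultiAdjointLattice c ℓ₁ ℓ₂ ι} {Sym : Set s}
  (ν : NegationOperator (ExtendedMultiAdjointLattice.multiAdjointLattice 𝓔))
  (ℙᵉ : EMALP 𝓔 Sym) (not : Sym → Sym) (fresh : IsFresh ℙᵉ not)
  (j : Sym → Fin (ExtendedMultiAdjointLattice.r 𝓔))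
  where

  open ExtendedMultiAdjointLattice 𝓔
  open NegationOperator ν
  open IsFresh fresh

  private
    𝓛 = multiAdjointLattice
    ℙ = correspondingMANLP ν ℙᵉ not fresh j

  translateRule∈ : ∀ {ρ} (ρ∈ : ρ ∈ ℙᵉ) → translateRule ν ℙᵉ not fresh j ρ∈ ∈ ℙ
  translateRule∈ ρ∈ = ∈-++⁺ˡ (mapWith∈⁺ (translateRule ν ℙᵉ not fresh j) (_ , ρ∈ , ≡.refl))

  negationRule∈ : ∀ {q} → q ∈ 𝒩 ℙᵉ → negationRule ν ℙᵉ not fresh j q ∈ ℙ
  negationRule∈ q∈ = ∈-++⁺ʳ (mapWith∈ ℙᵉ (translateRule ν ℙᵉ not fresh j))
    (∈-map⁺ (negationRule ν ℙᵉ not fresh j) q∈)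

  correspondingMANLP⁻ : ∀ {ρⁿ} → ρⁿ ∈ ℙ →
    (∃ λ ρ → ∃ λ (ρ∈ : ρ ∈ ℙᵉ) → ρⁿ ≡ translateRule ν ℙᵉ not fresh j ρ∈) ⊎
    (∃ λ q → q ∈ 𝒩 ℙᵉ × ρⁿ ≡ negationRule ν ℙᵉ not fresh j q)
  correspondingMANLP⁻ ρⁿ∈ with ∈-++⁻ (mapWith∈ ℙᵉ (translateRule ν ℙᵉ not fresh j)) ρⁿ∈
  ... | inj₁ ∈t = inj₁ (mapWith∈⁻ ℙᵉ (translateRule ν ℙᵉ not fresh j) ∈t)
  ... | inj₂ ∈n = inj₂ (∈-map⁻ (negationRule ν ℙᵉ not fresh j) ∈n)

  -- Heads and order-preserving arguments recur in the translated rule; an order-reversing argument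
  -- `q` is found in the body of the rule for `not q`.
  Πᵉ⊆Πⁿ : ∀ {p} → p ∈ Πᵉ ℙᵉ → p ∈ Πⁿ ℙ
  Πᵉ⊆Πⁿ p∈ with find (∈-concatMap⁻ ExtendedRule.symbols {xs = ℙᵉ} p∈)
  ... | ρ , ρ∈ , here ≡.refl =
    ∈-concatMap⁺ NormalRule.symbols (lose (translateRule∈ ρ∈) (here ≡.refl))
  ... | ρ , ρ∈ , there p∈ρ with ∈-++⁻ (toList (ExtendedRule.pos ρ)) p∈ρ
  ...   | inj₁ p∈pos with ∈-tabulate⁻ p∈pos
  ...     | i , ≡.refl = ∈-concatMap⁺ NormalRule.symbols $ lose (translateRule∈ ρ∈) $ there $ ∈-++⁺ˡ $
    ≡.subst (_∈ toList (pos ++ Vector.map not neg)) (lookup-++ˡ pos (Vector.map not neg) i)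
      (∈-tabulate⁺ (i ↑ˡ _))
    where open ExtendedRule ρ
  Πᵉ⊆Πⁿ p∈ | ρ , ρ∈ , there p∈ρ | inj₂ p∈neg with ∈-tabulate⁻ p∈neg
  ...     | i , ≡.refl = ∈-concatMap⁺ NormalRule.symbols
    (lose (negationRule∈ (neg∈𝒩 ℙᵉ ρ∈ i)) (there (here ≡.refl)))

  not∈Πⁿ : ∀ {q} → q ∈ 𝒩 ℙᵉ → not q ∈ Πⁿ ℙ
  not∈Πⁿ q∈ = ∈-concatMap⁺ NormalRule.symbols (lose (negationRule∈ q∈) (here ≡.refl))

  -- The alternative is read off the rule and position where `p` occurs; `extend` is defined by
  -- cases on it.
  Πⁿ⁻ : ∀ {p} → p ∈ Πⁿ ℙ → p ∈ Πᵉ ℙᵉ ⊎ (∃ λ q → q ∈ 𝒩 ℙᵉ × p ≡ not q)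
  Πⁿ⁻ p∈ with find (∈-concatMap⁻ NormalRule.symbols {xs = ℙ} p∈)
  ... | ρⁿ , ρⁿ∈ , p∈ρⁿ with correspondingMANLP⁻ ρⁿ∈
  Πⁿ⁻ p∈ | _ , _ , here ≡.refl         | inj₂ (q , q∈ , ≡.refl) = inj₂ (q , q∈ , ≡.refl)
  Πⁿ⁻ p∈ | _ , _ , there (here ≡.refl) | inj₂ (q , q∈ , ≡.refl) = inj₁ (𝒩⊆Πᵉ ℙᵉ q∈)
  Πⁿ⁻ p∈ | _ , _ , here ≡.refl         | inj₁ (ρ , ρ∈ , ≡.refl) = inj₁ (head∈Πᵉ ℙᵉ ρ∈)
  Πⁿ⁻ p∈ | _ , _ , there p∈ρⁿ          | inj₁ (ρ , ρ∈ , ≡.refl)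
    with ∈-++⁻ (toList (ExtendedRule.pos ρ ++ Vector.map not (ExtendedRule.neg ρ))) p∈ρⁿ
  ... | inj₁ p∈body with ∈-tabulate⁻ p∈body
  -- `++` computes through `splitAt`, so this split reveals which kind of symbol stands at `i`.
  ...   | i , ≡.refl with splitAt (Agg.m (ExtendedRule.agg ρ)) i
  ...     | inj₁ i′ = inj₁ (pos∈Πᵉ ℙᵉ ρ∈ i′)
  ...     | inj₂ i′ = inj₂ (_ , neg∈𝒩 ℙᵉ ρ∈ i′ , ≡.refl)

  -- Restricting and extending interpretations.

  restrict : Interpretation 𝓛 (Πⁿ ℙ) → Interpretation 𝓛 (Πᵉ ℙᵉ)
  restrict K = record
    { to   = λ (p , p∈) → K ⟨$⟩ (p , Πᵉ⊆Πⁿ p∈)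
    ; cong = Func.cong K
    }

  Extends : Interpretation 𝓛 (Πⁿ ℙ) → Interpretation 𝓛 (Πᵉ ℙᵉ) → Set _
  Extends K J = ∀ {p} (p∈Πᵉ : p ∈ Πᵉ ℙᵉ) (p∈Π : p ∈ Πⁿ ℙ) → K ⟨$⟩ (p , p∈Π) ≈ J ⟨$⟩ (p , p∈Πᵉ)

  restrict-extends : ∀ K → Extends K (restrict K)
  -- Here and below, `Func.cong` at `≡.refl` merely exchanges occurrence proofs of one symbol.
  restrict-extends K _ _ = Func.cong K ≡.refl

  module _ (Mᵉ : Interpretation 𝓛 (Πᵉ ℙᵉ)) where

    -- Kept apart because a model of the reduct of `ℙ` need only satisfy the first. Both refer to
    -- `Mᵉ`, since the reduct freezes negated symbols there.
    LowerNot UpperNot : Interpretation 𝓛 (Πⁿ ℙ) → Set _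
    LowerNot K = ∀ {q} (q∈ : q ∈ 𝒩 ℙᵉ) → ¬ (Mᵉ ⟨$⟩ (q , 𝒩⊆Πᵉ ℙᵉ q∈)) ≤ K ⟨$⟩ (not q , not∈Πⁿ q∈)
    UpperNot K = ∀ {q} (q∈ : q ∈ 𝒩 ℙᵉ) → K ⟨$⟩ (not q , not∈Πⁿ q∈) ≤ ¬ (Mᵉ ⟨$⟩ (q , 𝒩⊆Πᵉ ℙᵉ q∈))

    module _ (J : Interpretation 𝓛 (Πᵉ ℙᵉ)) where

      private
        value : ∀ {p} → p ∈ Πᵉ ℙᵉ ⊎ (∃ λ q → q ∈ 𝒩 ℙᵉ × p ≡ not q) → Carrier
        value {p} (inj₁ p∈Πᵉ)         = J ⟨$⟩ (p , p∈Πᵉ)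
        value     (inj₂ (q , q∈ , _)) = ¬ (Mᵉ ⟨$⟩ (q , 𝒩⊆Πᵉ ℙᵉ q∈))

        -- Freshness makes the alternatives exclusive, so the extension is well
        -- defined although equality of symbols need not be decidable.
        value-cong : ∀ {p} (u v : p ∈ Πᵉ ℙᵉ ⊎ (∃ λ q → q ∈ 𝒩 ℙᵉ × p ≡ not q)) → value u ≈ value v
        value-cong (inj₁ _)  (inj₁ _) = Func.cong J ≡.refl
        value-cong (inj₁ p∈) (inj₂ (q , q∈ , ≡.refl)) = contradiction p∈ (not∉Π q∈)
        value-cong (inj₂ (q , q∈ , ≡.refl)) (inj₁ p∈) = contradiction p∈ (not∉Π q∈)
        value-cong (inj₂ (q , q∈ , eq)) (inj₂ (q′ , q′∈ , eq′)) =
          ¬-cong ν (Func.cong Mᵉ (not-injective q∈ q′∈ (≡.trans (≡.sym eq) eq′)))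

      extend : Interpretation 𝓛 (Πⁿ ℙ)
      extend = record
        { to   = λ (_ , p∈) → value (Πⁿ⁻ p∈)
        ; cong = λ { {_ , p∈} {_ , p∈′} ≡.refl → value-cong (Πⁿ⁻ p∈) (Πⁿ⁻ p∈′) }
        }

      extend-extends : Extends extend J
      extend-extends p∈Πᵉ p∈Π = value-cong (Πⁿ⁻ p∈Π) (inj₁ p∈Πᵉ)

      extend-not : ∀ {q} (q∈ : q ∈ 𝒩 ℙᵉ) →
                   extend ⟨$⟩ (not q , not∈Πⁿ q∈) ≈ ¬ (Mᵉ ⟨$⟩ (q , 𝒩⊆Πᵉ ℙᵉ q∈))
      extend-not q∈ = value-cong (Πⁿ⁻ (not∈Πⁿ q∈)) (inj₂ (_ , q∈ , ≡.refl))

    -- Comparing the two reducts.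

    module Reducts
      (¬-involutive : IsInvolutive)
      (M : Interpretation 𝓛 (Πⁿ ℙ)) (M-extends : Extends M Mᵉ)
      where

      module _ {ρ} (ρ∈ : ρ ∈ ℙᵉ) (ρⁿ∈ : translateRule ν ℙᵉ not fresh j ρ∈ ∈ ℙ)
               (K : Interpretation 𝓛 (Πⁿ ℙ)) (J : Interpretation 𝓛 (Πᵉ ℙᵉ))
               (ext : Extends K J) where

        open ExtendedRule ρ
        open Agg agg using (m; k)

        private
          bodyᵉ bodyⁿ : Carrier
          bodyᵉ = AggregatorOperator.apply op (Vector.map (J ⟨$⟩_) args)
            where open PositiveRule (reductRuleᵉ ℙᵉ Mᵉ ρ∈)
          bodyⁿ = AggregatorOperator.apply op (Vector.map (K ⟨$⟩_) args)
            where open PositiveRule (reductRuleⁿ ℙ M ρⁿ∈)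

          argⁿ : Vector Carrier (m + k)
          argⁿ i = K ⟨$⟩ PositiveRule.args (reductRuleⁿ ℙ M ρⁿ∈) i

          argⁿ-pos : ∀ i → argⁿ (i ↑ˡ k) ≈ J ⟨$⟩ (pos i , pos∈Πᵉ ℙᵉ ρ∈ i)
          argⁿ-pos i = Eq.trans
            (Func.cong K {y = _ , Πᵉ⊆Πⁿ (pos∈Πᵉ ℙᵉ ρ∈ i)} (lookup-++ˡ pos (Vector.map not neg) i))
            (ext _ _)

          argⁿ-neg : ∀ i → argⁿ (m ↑ʳ i) ≈ K ⟨$⟩ (not (neg i) , not∈Πⁿ (neg∈𝒩 ℙᵉ ρ∈ i))
          argⁿ-neg i = Func.cong K (lookup-++ʳ pos (Vector.map not neg) i)

          -- The reduct appends an empty vector of negated values to the arguments, and `take`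
          -- strips it off again, but not definitionally.
          vᵢ≈argⁿᵢ : ∀ (ys : Vector Carrier 0) i → take (m + k) (argⁿ ++ ys) i ≈ argⁿ i
          vᵢ≈argⁿᵢ ys i = Eq.reflexive (lookup-++ˡ argⁿ ys i)

        -- Antitonicity and involutivity turn `¬ Mᵉ q ≤ K (not q)` into `¬ K (not q) ≤ Mᵉ q`, in an
        -- argument where the aggregator reverses order.
        bodyᵉ≤bodyⁿ : LowerNot K → bodyᵉ ≤ bodyⁿ
        bodyᵉ≤bodyⁿ lower = apply-++≤apply¬ {𝓔 = 𝓔} {Sym = Sym} ν (aggregator agg)
          {v = take (m + k) (argⁿ ++ _)}
          (λ i → reflexive (Eq.sym (Eq.trans (vᵢ≈argⁿᵢ _ (i ↑ˡ k)) (argⁿ-pos i))))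
          (λ i → trans
            (antitone (trans (lower (neg∈𝒩 ℙᵉ ρ∈ i))
              (reflexive (Eq.sym (Eq.trans (vᵢ≈argⁿᵢ _ (m ↑ʳ i)) (argⁿ-neg i))))))
            (reflexive (Eq.trans (¬-involutive _) (Func.cong Mᵉ ≡.refl))))

        bodyⁿ≤bodyᵉ : UpperNot K → bodyⁿ ≤ bodyᵉ
        bodyⁿ≤bodyᵉ upper = apply¬≤apply-++ {𝓔 = 𝓔} {Sym = Sym} ν (aggregator agg)
          {v = take (m + k) (argⁿ ++ _)}
          (λ i → reflexive (Eq.trans (vᵢ≈argⁿᵢ _ (i ↑ˡ k)) (argⁿ-pos i)))
          (λ i → trans
            (reflexive (Eq.trans (Func.cong Mᵉ ≡.refl) (Eq.sym (¬-involutive _))))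
            (antitone (trans (reflexive (Eq.trans (vᵢ≈argⁿᵢ _ (m ↑ʳ i)) (argⁿ-neg i)))
              (upper (neg∈𝒩 ℙᵉ ρ∈ i)))))

      module _ {K : Interpretation 𝓛 (Πⁿ ℙ)} where

        -- In the reduct the rule for `not q` has the constant body `¬ M q` and weight `⊤`.
        reductⁿ-lowerNot : IsModel 𝓛 (reductⁿ ℙ M) K → LowerNot K
        reductⁿ-lowerNot model {q} q∈ = trans
          (reflexive (¬-cong ν (Eq.sym (M-extends _ _))))
          (trans
            (⊤≤←⁻ 𝓛 (j q)
              (IsModel-mapWith∈⁻ 𝓛 {f = reductRuleⁿ ℙ M} {I = K} model (negationRule∈ q∈)))
            (reflexive (Func.cong K ≡.refl)))

        module _ {J : Interpretation 𝓛 (Πᵉ ℙᵉ)} (ext : Extends K J) where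

          -- Heads keep their values and bodies can only shrink, which raises the implication.
          reductⁿ⇒reductᵉ : IsModel 𝓛 (reductⁿ ℙ M) K → IsModel 𝓛 (reductᵉ ℙᵉ Mᵉ) J
          reductⁿ⇒reductᵉ model = IsModel-mapWith∈⁺ 𝓛 {f = reductRuleᵉ ℙᵉ Mᵉ} {I = J} λ {ρ} ρ∈ →
            ←-mono-≤ 𝓛 (ExtendedRule.index ρ) (reflexive (ext _ _))
              (bodyᵉ≤bodyⁿ ρ∈ (translateRule∈ ρ∈) K J ext (reductⁿ-lowerNot model))
              (IsModel-mapWith∈⁻ 𝓛 {f = reductRuleⁿ ℙ M} {I = K} model (translateRule∈ ρ∈))

          -- `upper` keeps translated bodies below the original ones; `lower` satisfies the rules
          -- for the symbols `not q`.
          reductᵉ⇒reductⁿ : LowerNot K → UpperNot K →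
                            IsModel 𝓛 (reductᵉ ℙᵉ Mᵉ) J → IsModel 𝓛 (reductⁿ ℙ M) K
          reductᵉ⇒reductⁿ lower upper model =
            IsModel-mapWith∈⁺ 𝓛 {f = reductRuleⁿ ℙ M} {I = K} satisfies
            where
            satisfies : ∀ {ρⁿ} (ρⁿ∈ : ρⁿ ∈ ℙ) → Satisfies 𝓛 K (reductRuleⁿ ℙ M ρⁿ∈)
            satisfies ρⁿ∈ with correspondingMANLP⁻ ρⁿ∈
            ... | inj₁ (ρ , ρ∈ , ≡.refl) =
              ←-mono-≤ 𝓛 (ExtendedRule.index ρ) (reflexive (Eq.sym (ext _ _)))
                (bodyⁿ≤bodyᵉ ρ∈ ρⁿ∈ K J ext upper)
                (IsModel-mapWith∈⁻ 𝓛 {f = reductRuleᵉ ℙᵉ Mᵉ} {I = J} model ρ∈)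
            ... | inj₂ (q , q∈ , ≡.refl) = ⊤≤←⁺ 𝓛 (j q)
              (trans (reflexive (¬-cong ν (M-extends _ _)))
                (trans (lower q∈) (reflexive (Func.cong K ≡.refl))))

-- Transfer of least models between the two reducts.

theorem23 : {c ℓ₁ ℓ₂ ι s : Level} (𝓔 : ExtendedMultiAdjointLattice c ℓ₁ ℓ₂ ι) →
    let open ExtendedMultiAdjointLattice 𝓔 in
    (ν : NegationOperator multiAdjointLattice) →
    let open NegationOperator ν in
    IsInvolutive →
    {Sym : Set s} (ℙᵉ : EMALP 𝓔 Sym) →
    (not : Sym → Sym) (fresh : IsFresh ℙᵉ not) (j : Sym → Fin r) →
    let ℙ = correspondingMANLP ν ℙᵉ not fresh j in
    (Mᵉ : Interpretation multiAdjointLattice (Πᵉ ℙᵉ)) →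
    (M : Interpretation multiAdjointLattice (Πⁿ ℙ)) →
    (∀ {p} (p∈Πᵉ : p ∈ Πᵉ ℙᵉ) (p∈Π : p ∈ Πⁿ ℙ) → (M ⟨$⟩ (p , p∈Π)) ≈ (Mᵉ ⟨$⟩ (p , p∈Πᵉ))) →
    (∀ {q} → q ∈ 𝒩 ℙᵉ → (q∈Π : q ∈ Πⁿ ℙ) (not∈Π : not q ∈ Πⁿ ℙ) →
    (M ⟨$⟩ (not q , not∈Π)) ≈ ¬ (M ⟨$⟩ (q , q∈Π))) →
    IsStableModelᵉ ℙᵉ Mᵉ ⇔ IsStableModelⁿ ℙ M
theorem23 𝓔 ν ¬-involutive ℙᵉ not fresh j Mᵉ M M-extends M-not = mk⇔ to from
  where
  open ExtendedMultiAdjointLattice 𝓔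
  open NegationOperator ν
  open Translation ν ℙᵉ not fresh j
  open Reducts Mᵉ ¬-involutive M M-extends

  ℙ = correspondingMANLP ν ℙᵉ not fresh j

  M-not≈ : ∀ {q} (q∈ : q ∈ 𝒩 ℙᵉ) (not∈Π : not q ∈ Πⁿ ℙ) →
           M ⟨$⟩ (not q , not∈Π) ≈ ¬ (Mᵉ ⟨$⟩ (q , 𝒩⊆Πᵉ ℙᵉ q∈))
  M-not≈ q∈ not∈Π = Eq.trans
    (M-not q∈ (Πᵉ⊆Πⁿ (𝒩⊆Πᵉ ℙᵉ q∈)) not∈Π)
    (¬-cong ν (M-extends _ _))

  to : IsStableModelᵉ ℙᵉ Mᵉ → IsStableModelⁿ ℙ M
  to (model , least) =
      reductᵉ⇒reductⁿ {K = M} {J = Mᵉ} M-extends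
        (λ q∈ → reflexive (Eq.sym (M-not≈ q∈ _))) (λ q∈ → reflexive (M-not≈ q∈ _)) model
    , below
    where
    below : ∀ K → IsModel multiAdjointLattice (reductⁿ ℙ M) K → ∀ p → M ⟨$⟩ p ≤ K ⟨$⟩ p
    below K K-model (p , p∈Π) with Πⁿ⁻ p∈Π
    -- On an original symbol, leastness of `Mᵉ` is applied to the restriction of `K`.
    ... | inj₁ p∈Πᵉ = trans (reflexive (M-extends p∈Πᵉ p∈Π))
      (trans
        (least K↾ (reductⁿ⇒reductᵉ {K = K} {J = K↾} (restrict-extends K) K-model) (p , p∈Πᵉ))
        (reflexive (Func.cong K ≡.refl)))
      where K↾ = restrict K
    -- On a new symbol, the bound comes from the rule for `not q` in the reduct.
    ... | inj₂ (q , q∈ , ≡.refl) = trans (reflexive (M-not≈ q∈ p∈Π))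
      (trans (reductⁿ-lowerNot {K = K} K-model q∈) (reflexive (Func.cong K ≡.refl)))

  from : IsStableModelⁿ ℙ M → IsStableModelᵉ ℙᵉ Mᵉ
  from (model , least) =
      reductⁿ⇒reductᵉ {K = M} {J = Mᵉ} M-extends model
    , λ J J-model (p , p∈Πᵉ) →
        -- Giving each `not q` the value `¬ Mᵉ q` makes `J⁺` a model of the reduct of `ℙ`, so
        -- leastness of `M` applies to it.
        let J⁺     = extend Mᵉ J
            J⁺-ext = extend-extends Mᵉ J
            J⁺-not = extend-not Mᵉ J
            p∈Π    = Πᵉ⊆Πⁿ p∈Πᵉ
        in trans (reflexive (Eq.sym (M-extends p∈Πᵉ p∈Π)))
          (trans
            (least J⁺
              (reductᵉ⇒reductⁿ {K = J⁺} {J = J} J⁺-ext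
                (λ q∈ → reflexive (Eq.sym (J⁺-not q∈))) (λ q∈ → reflexive (J⁺-not q∈)) J-model)
              (p , p∈Π))
            (reflexive (J⁺-ext p∈Πᵉ p∈Π)))
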